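{- (In $\mathsf{ZF}$.) For all sets $X$ and $Y$, if $\mathsf{DC}(X)$ and $\mathsf{DC}(Y)$ hold, then $\mathsf{DC}(X \cup Y)$ holds.
   Context: Work in $\mathsf{ZF}$. For a set $Z$, $\mathsf{DC}(Z)$: for every nonempty binary relation $R\subseteq Z\times Z$ total on $Z$ (for every $z\in Z$ there is $w\in Z$ with $z\mathrel R w$) there is $(z_n)_{n\in\omega}$ in $Z$ with $z_n\mathrel R z_{n+1}$ for all $n$. -}

module Defs where

open import Data.Fin.Base using (Fin)
open import Data.Fin.Patterns using (0F; 1F; 2F)
open import Data.Nat.Base using (ℕ; suc)
open import Data.Product using (∃; ∃₂; ∃!; _×_; _,_; proj₁; proj₂)
open import Data.Sum using (_⊎_)
open import Data.Vec.Base using (Vec; []; _∷_; lookup)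
open import Function.Bundles using (_⇔_; mk⇔; module Equivalence)
open import Level using (Level) renaming (suc to lsuc)
open import Relation.Binary.PropositionalEquality using (_≡_)
open import Relation.Nullary using (¬_)

-- First-order formulas of the language {∈, =}, with n free variables
-- given as de Bruijn indices.  They are needed to state the separation
-- and replacement schemas: quantifying over Agda predicates instead would
-- give second-order ZF and, since Agda's ∃ carries witnesses, would leak
-- choice into the model.

infix  8 _∈ᶠ_ _≐ᶠ_
infix  7 ¬ᶠ_
infixr 6 _∧ᶠ_
infixr 5 _∨ᶠ_
infixr 4 _⇒ᶠ_
infix  3 _⇔ᶠ_

data Formula (n : ℕ) : Set where
  _∈ᶠ_ _≐ᶠ_                : Fin n → Fin n → Formula n
  ¬ᶠ_                      : Formula n → Formula n
  _∧ᶠ_ _∨ᶠ_ _⇒ᶠ_ _⇔ᶠ_      : Formula n → Formula n → Formula n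
  ∀ᶠ ∃ᶠ                    : Formula (suc n) → Formula n

module Satisfaction {ℓ : Level} (V : Set ℓ) (_∈_ : V → V → Set ℓ) where

  Sat : ∀ {n} → Formula n → Vec V n → Set ℓ
  Sat (i ∈ᶠ j) ρ = lookup ρ i ∈ lookup ρ j
  Sat (i ≐ᶠ j) ρ = lookup ρ i ≡ lookup ρ j
  Sat (¬ᶠ φ)   ρ = ¬ Sat φ ρ
  Sat (φ ∧ᶠ ψ) ρ = Sat φ ρ × Sat ψ ρ
  Sat (φ ∨ᶠ ψ) ρ = Sat φ ρ ⊎ Sat ψ ρ
  Sat (φ ⇒ᶠ ψ) ρ = Sat φ ρ → Sat ψ ρ
  Sat (φ ⇔ᶠ ψ) ρ = Sat φ ρ ⇔ Sat ψ ρ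
  Sat (∀ᶠ φ)   ρ = ∀ x → Sat φ (x ∷ ρ)
  Sat (∃ᶠ φ)   ρ = ∃ λ x → Sat φ (x ∷ ρ)

-- Models of first-order ZF; a theorem of ZF is read as a statement about
-- an arbitrary such model.  Classical logic is not built in: it has to be
-- assumed of the metatheory.  A metatheory with excluded middle can choose
-- elements of V outside the model, but such choices are not sets of the
-- model, because the two schemas range over formulas only.

record ZF (ℓ : Level) : Set (lsuc ℓ) where
  infix 4 _∈_ _⊆_
  field
    V   : Set ℓ
    _∈_ : V → V → Set ℓ

  open Satisfaction V _∈_ public

  _⊆_ : V → V → Set ℓ
  x ⊆ y = ∀ z → z ∈ x → z ∈ y

  IsEmpty : V → Set ℓ
  IsEmpty x = ∀ z → ¬ (z ∈ x)

  IsSuc : V → V → Set ℓ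
  IsSuc s n = ∀ z → z ∈ s ⇔ (z ∈ n ⊎ z ≡ n)

  Inductive : V → Set ℓ
  Inductive w = (∃ λ e → IsEmpty e × e ∈ w)
              × (∀ n → n ∈ w → ∃ λ s → IsSuc s n × s ∈ w)

  field
    extensionality : ∀ x y → (∀ z → z ∈ x ⇔ z ∈ y) → x ≡ y
    foundation     : ∀ x → (∃ λ y → y ∈ x) →
                     ∃ λ y → y ∈ x × (∀ z → z ∈ y → ¬ (z ∈ x))
    pairing        : ∀ x y → ∃ λ p → ∀ z → z ∈ p ⇔ (z ≡ x ⊎ z ≡ y)
    union          : ∀ x → ∃ λ u → ∀ z → z ∈ u ⇔ (∃ λ y → y ∈ x × z ∈ y)
    powerset       : ∀ x → ∃ λ p → ∀ z → z ∈ p ⇔ z ⊆ x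
    infinity       : ∃ Inductive
    separation     : ∀ {n} (φ : Formula (suc n)) (ρ : Vec V n) a →
                     ∃ λ b → ∀ x → x ∈ b ⇔ (x ∈ a × Sat φ (x ∷ ρ))
    replacement    : ∀ {n} (φ : Formula (suc (suc n))) (ρ : Vec V n) a →
                     (∀ x → x ∈ a → ∀ y y′ →
                       Sat φ (x ∷ y ∷ ρ) → Sat φ (x ∷ y′ ∷ ρ) → y ≡ y′) →
                     ∃ λ b → ∀ y → y ∈ b ⇔ (∃ λ x → x ∈ a × Sat φ (x ∷ y ∷ ρ))

module SetTheory {ℓ : Level} (M : ZF ℓ) where
  open ZF M public

  infixl 6 _∪_
  infix  4 _∶_⟶_

  ｛_,_｝ : V → V → V
  ｛ x , y ｝ = proj₁ (pairing x y)

  ⋃ : V → V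
  ⋃ x = proj₁ (union x)

  _∪_ : V → V → V
  x ∪ y = ⋃ ｛ x , y ｝

  ⟨_,_⟩ : V → V → V
  ⟨ x , y ⟩ = ｛ ｛ x , x ｝ , ｛ x , y ｝ ｝

  succ : V → V
  succ n = n ∪ ｛ n , n ｝

  -- Sat inductiveᶠ (w ∷ ρ) is definitionally Inductive w.
  inductiveᶠ : ∀ {n} → Formula (suc n)
  inductiveᶠ =
    ∃ᶠ (∀ᶠ (¬ᶠ (0F ∈ᶠ 1F)) ∧ᶠ 0F ∈ᶠ 1F)
    ∧ᶠ ∀ᶠ (0F ∈ᶠ 1F ⇒ᶠ
           ∃ᶠ (∀ᶠ (0F ∈ᶠ 1F ⇔ᶠ 0F ∈ᶠ 2F ∨ᶠ 0F ≐ᶠ 2F) ∧ᶠ 0F ∈ᶠ 2F))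

  omega : ∃ λ w → ∀ n → n ∈ w ⇔ (∀ v → Inductive v → n ∈ v)
  omega = w , λ n → mk⇔ (λ n∈w → proj₂ (Equivalence.to (w-spec n) n∈w))
                        (λ h → Equivalence.from (w-spec n) (h I I-ind , h))
    where
    I     = proj₁ infinity
    I-ind = proj₂ infinity
    sep   = separation (∀ᶠ (inductiveᶠ ⇒ᶠ 1F ∈ᶠ 0F)) [] I
    w     = proj₁ sep
    w-spec = proj₂ sep

  ω : V
  ω = proj₁ omega

  -- r is a set of ordered pairs included in A × B.
  RelationBetween : V → V → V → Set ℓ
  RelationBetween r A B =
    ∀ p → p ∈ r → ∃₂ λ x y → x ∈ A × y ∈ B × p ≡ ⟨ x , y ⟩

  _∶_⟶_ : V → V → V → Set ℓ
  f ∶ A ⟶ B = RelationBetween f A B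
            × (∀ x → x ∈ A → ∃! _≡_ λ y → ⟨ x , y ⟩ ∈ f)

  TotalOn : V → V → Set ℓ
  TotalOn R Z = ∀ z → z ∈ Z → ∃ λ w → w ∈ Z × ⟨ z , w ⟩ ∈ R

  DC : V → Set ℓ
  DC Z = ∀ R → RelationBetween R Z Z → (∃ λ p → p ∈ R) → TotalOn R Z →
         ∃ λ f → f ∶ ω ⟶ Z ×
                 (∀ n → n ∈ ω → ∀ x y → ⟨ n , x ⟩ ∈ f → ⟨ succ n , y ⟩ ∈ f →
                   ⟨ x , y ⟩ ∈ R)

{-# OPTIONS --safe #-}
module Submission where

-- Let R be total on W.  If R is total on some nonempty subset of W ∖ X,
-- restrict to it.  Otherwise every point of W has an R-path into X, so DC(X)
-- yields a sequence in X whose consecutive terms are joined by R-paths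
-- through W ∖ X.  These paths need not be chosen: take T to be the range A′ of
-- the sequence together with all points of W ∖ X having a path into A′ through
-- W ∖ X.  Then R is total on T and T ∩ X is countable, so R can be thinned,
-- staying total, until it allows at most one move whenever it allows a move
-- into X.  Doing this for X and then for Y leaves a function on a nonempty
-- subset of X ∪ Y, and iterating it gives the sequence.
--
-- Paths are replaced by quantification over sets closed under predecessors,
-- which needs neither finite sequences nor a choice of paths.

open import Defs
open import Axiom.ExcludedMiddle using (ExcludedMiddle)
open import Data.Empty using (⊥-elim)
open import Data.Fin.Base using (Fin; suc)
open import Data.Fin.Patterns using (0F; 1F; 2F; 3F; 4F; 5F; 6F; 7F; 8F; 9F)
open import Data.Nat.Base using (ℕ)
open import Data.Product using (∃; ∃₂; _×_; _,_; proj₁; proj₂)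
open import Data.Product.Function.NonDependent.Propositional using (_×-⇔_)
open import Data.Sum using (_⊎_; inj₁; inj₂; [_,_]′)
open import Data.Sum.Function.Propositional using (_⊎-⇔_)
open import Data.Vec.Base using (Vec; []; _∷_; lookup)
open import Function.Base using (_∘_; id)
open import Function.Bundles using (_⇔_; mk⇔; module Equivalence)
open import Function.Properties.Equivalence using () renaming (trans to ⇔-trans; sym to ⇔-sym)
open import Relation.Binary.PropositionalEquality using (_≡_; refl; sym; trans; cong; subst; subst₂)
open import Relation.Nullary using (¬_; yes; no)
open import Relation.Nullary.Decidable using (decidable-stable)

open Equivalence using (to; from)

-- Formulas over terms, translated into the language of `∈` and `=`.

infix 9 #_ ⋃ᵗ_
infix 8 _∈ᵗ_ _≐ᵗ_
infix 7 ¬ᵗ_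
infixr 6 _∧ᵗ_
infixr 5 _∨ᵗ_
infixr 4 _⇒ᵗ_

data Term (n : ℕ) : Set where
  #_     : Fin n → Term n
  ｛_,_｝ᵗ : Term n → Term n → Term n
  ⋃ᵗ_    : Term n → Term n

⟨_,_⟩ᵗ : ∀ {n} → Term n → Term n → Term n
⟨ t , u ⟩ᵗ = ｛ ｛ t , t ｝ᵗ , ｛ t , u ｝ᵗ ｝ᵗ

succᵗ : ∀ {n} → Term n → Term n
succᵗ t = ⋃ᵗ ｛ t , ｛ t , t ｝ᵗ ｝ᵗ

-- Formulas whose atoms may mention pairs and unions, which the language
-- {∈, =} has to spell out.
data TFormula (n : ℕ) : Set where
  _∈ᵗ_ _≐ᵗ_           : Term n → Term n → TFormula n
  ¬ᵗ_                 : TFormula n → TFormula n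
  _∧ᵗ_ _∨ᵗ_ _⇒ᵗ_      : TFormula n → TFormula n → TFormula n
  ∀ᵗ ∃ᵗ               : TFormula (ℕ.suc n) → TFormula n

-- This formula expresses that variable `i` is the value of the term. Only the renaming `σ` changes
-- under binders, so the term is never weakened.
graph : ∀ {m n} → Term m → (Fin m → Fin n) → Fin n → Formula n
graph (# j)        σ i = i ≐ᶠ σ j
graph ｛ t , u ｝ᵗ σ i =
  ∀ᶠ (0F ∈ᶠ suc i ⇔ᶠ graph t (suc ∘ σ) 0F ∨ᶠ graph u (suc ∘ σ) 0F)
graph (⋃ᵗ t)       σ i =
  ∃ᶠ (graph t (suc ∘ σ) 0F ∧ᶠ
      ∀ᶠ (0F ∈ᶠ suc (suc i) ⇔ᶠ ∃ᶠ (0F ∈ᶠ 2F ∧ᶠ 1F ∈ᶠ 0F)))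

⌜_⌝ : ∀ {n} → TFormula n → Formula n
⌜ t ∈ᵗ u ⌝ = ∃ᶠ (∃ᶠ (graph t (suc ∘ suc) 1F ∧ᶠ graph u (suc ∘ suc) 0F ∧ᶠ 1F ∈ᶠ 0F))
⌜ t ≐ᵗ u ⌝ = ∃ᶠ (graph t suc 0F ∧ᶠ graph u suc 0F)
⌜ ¬ᵗ φ ⌝   = ¬ᶠ ⌜ φ ⌝
⌜ φ ∧ᵗ ψ ⌝ = ⌜ φ ⌝ ∧ᶠ ⌜ ψ ⌝
⌜ φ ∨ᵗ ψ ⌝ = ⌜ φ ⌝ ∨ᶠ ⌜ ψ ⌝
⌜ φ ⇒ᵗ ψ ⌝ = ⌜ φ ⌝ ⇒ᶠ ⌜ ψ ⌝
⌜ ∀ᵗ φ ⌝   = ∀ᶠ ⌜ φ ⌝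
⌜ ∃ᵗ φ ⌝   = ∃ᶠ ⌜ φ ⌝

-- Correctness of the translation, Kuratowski pairs, definable relations.

module Sets {ℓ} (M : ZF ℓ) where
  open SetTheory M

  -- Environments are functions because `lookup (z ∷ ρ) ∘ (suc ∘ σ)` is then definitionally
  -- `lookup ρ ∘ σ`, which lets `graph-sat` recurse under binders.
  ⟦_⟧ : ∀ {n} → Term n → (Fin n → V) → V
  ⟦ # i ⟧          ρ = ρ i
  ⟦ ｛ t , u ｝ᵗ ⟧ ρ = ｛ ⟦ t ⟧ ρ , ⟦ u ⟧ ρ ｝
  ⟦ ⋃ᵗ t ⟧         ρ = ⋃ (⟦ t ⟧ ρ)

  SatT : ∀ {n} → TFormula n → Vec V n → Set ℓ
  SatT (t ∈ᵗ u) ρ = ⟦ t ⟧ (lookup ρ) ∈ ⟦ u ⟧ (lookup ρ)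
  SatT (t ≐ᵗ u) ρ = ⟦ t ⟧ (lookup ρ) ≡ ⟦ u ⟧ (lookup ρ)
  SatT (¬ᵗ φ)   ρ = ¬ SatT φ ρ
  SatT (φ ∧ᵗ ψ) ρ = SatT φ ρ × SatT ψ ρ
  SatT (φ ∨ᵗ ψ) ρ = SatT φ ρ ⊎ SatT ψ ρ
  SatT (φ ⇒ᵗ ψ) ρ = SatT φ ρ → SatT ψ ρ
  SatT (∀ᵗ φ)   ρ = ∀ x → SatT φ (x ∷ ρ)
  SatT (∃ᵗ φ)   ρ = ∃ λ x → SatT φ (x ∷ ρ)

  ∈｛｝ : ∀ {x y z} → z ∈ ｛ x , y ｝ ⇔ (z ≡ x ⊎ z ≡ y)
  ∈｛｝ {x} {y} {z} = proj₂ (pairing x y) z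

  ∈⋃ : ∀ {x z} → z ∈ ⋃ x ⇔ (∃ λ y → y ∈ x × z ∈ y)
  ∈⋃ {x} {z} = proj₂ (union x) z

  -- By extensionality a specification has only one solution. This turns the formulas that spell out
  -- pairs and unions into equations.
  determined : ∀ {x y} {P : V → Set ℓ} → (∀ z → z ∈ y ⇔ P z) →
               (∀ z → z ∈ x ⇔ P z) ⇔ x ≡ y
  determined y-spec = mk⇔
    (λ x-spec → extensionality _ _ λ z → ⇔-trans (x-spec z) (⇔-sym (y-spec z)))
    (λ x≡y z → subst (λ s → z ∈ s ⇔ _) (sym x≡y) (y-spec z))

  graph-sat : ∀ {m n} (t : Term m) (σ : Fin m → Fin n) i (ρ : Vec V n) →
              Sat (graph t σ i) ρ ⇔ lookup ρ i ≡ ⟦ t ⟧ (lookup ρ ∘ σ)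
  graph-sat (# j) σ i ρ = mk⇔ id id
  graph-sat ｛ t , u ｝ᵗ σ i ρ = determined λ z → ⇔-trans ∈｛｝
    (⇔-sym (graph-sat t (suc ∘ σ) 0F (z ∷ ρ) ⊎-⇔ graph-sat u (suc ∘ σ) 0F (z ∷ ρ)))
  graph-sat (⋃ᵗ t) σ i ρ = mk⇔
    (λ where (y , y-sat , h) → trans (to (determined λ z → ∈⋃) h)
                                     (cong ⋃ (to (graph-sat t (suc ∘ σ) 0F (y ∷ ρ)) y-sat)))
    (λ e → _ , from (graph-sat t (suc ∘ σ) 0F (_ ∷ ρ)) refl , from (determined λ z → ∈⋃) e)

  ⌜⌝-sat : ∀ {n} (φ : TFormula n) (ρ : Vec V n) → Sat ⌜ φ ⌝ ρ ⇔ SatT φ ρ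
  ⌜⌝-sat (t ∈ᵗ u) ρ = mk⇔
    (λ where (x , y , p , q , r) →
               subst₂ _∈_ (to (graph-sat t (suc ∘ suc) 1F (y ∷ x ∷ ρ)) p)
                          (to (graph-sat u (suc ∘ suc) 0F (y ∷ x ∷ ρ)) q) r)
    (λ r → _ , _ , from (graph-sat t (suc ∘ suc) 1F (_ ∷ _ ∷ ρ)) refl
                 , from (graph-sat u (suc ∘ suc) 0F (_ ∷ _ ∷ ρ)) refl , r)
  ⌜⌝-sat (t ≐ᵗ u) ρ = mk⇔
    (λ where (x , p , q) → trans (sym (to (graph-sat t suc 0F (x ∷ ρ)) p))
                                 (to (graph-sat u suc 0F (x ∷ ρ)) q))
    (λ r → _ , from (graph-sat t suc 0F (_ ∷ ρ)) refl , from (graph-sat u suc 0F (_ ∷ ρ)) r)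
  ⌜⌝-sat (¬ᵗ φ)   ρ = mk⇔ (_∘ from (⌜⌝-sat φ ρ)) (_∘ to (⌜⌝-sat φ ρ))
  ⌜⌝-sat (φ ∧ᵗ ψ) ρ = ⌜⌝-sat φ ρ ×-⇔ ⌜⌝-sat ψ ρ
  ⌜⌝-sat (φ ∨ᵗ ψ) ρ = ⌜⌝-sat φ ρ ⊎-⇔ ⌜⌝-sat ψ ρ
  ⌜⌝-sat (φ ⇒ᵗ ψ) ρ = mk⇔ (λ h → to (⌜⌝-sat ψ ρ) ∘ h ∘ from (⌜⌝-sat φ ρ))
                          (λ h → from (⌜⌝-sat ψ ρ) ∘ h ∘ to (⌜⌝-sat φ ρ))
  ⌜⌝-sat (∀ᵗ φ)   ρ = mk⇔ (λ h x → to (⌜⌝-sat φ (x ∷ ρ)) (h x))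
                          (λ h x → from (⌜⌝-sat φ (x ∷ ρ)) (h x))
  ⌜⌝-sat (∃ᵗ φ)   ρ = mk⇔ (λ where (x , h) → x , to (⌜⌝-sat φ (x ∷ ρ)) h)
                          (λ where (x , h) → x , from (⌜⌝-sat φ (x ∷ ρ)) h)

  abstract
    comprehension : ∀ {n} (φ : TFormula (ℕ.suc n)) (ρ : Vec V n) a →
                    ∃ λ b → ∀ x → x ∈ b ⇔ (x ∈ a × SatT φ (x ∷ ρ))
    comprehension φ ρ a with separation ⌜ φ ⌝ ρ a
    ... | b , h = b , λ x → ⇔-trans (h x) (mk⇔ id id ×-⇔ ⌜⌝-sat φ (x ∷ ρ))

  ∈∪ : ∀ {x y z} → z ∈ x ∪ y ⇔ (z ∈ x ⊎ z ∈ y)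
  ∈∪ {x} {y} {z} = mk⇔
    (λ h → let u , u∈ , z∈u = to ∈⋃ h in
           [ (λ e → inj₁ (subst (z ∈_) e z∈u)) , (λ e → inj₂ (subst (z ∈_) e z∈u)) ]′ (to ∈｛｝ u∈))
    [ (λ h → from ∈⋃ (x , from ∈｛｝ (inj₁ refl) , h))
    , (λ h → from ∈⋃ (y , from ∈｛｝ (inj₂ refl) , h)) ]′

  ∈succ : ∀ {n z} → z ∈ succ n ⇔ (z ∈ n ⊎ z ≡ n)
  ∈succ = ⇔-trans ∈∪ (mk⇔ id id ⊎-⇔ ⇔-trans ∈｛｝ (mk⇔ [ id , id ]′ inj₁))

  abstract
    ⟨⟩-injective : ∀ {a b c d} → ⟨ a , b ⟩ ≡ ⟨ c , d ⟩ → a ≡ c × b ≡ d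
    ⟨⟩-injective {a} {b} {c} {d} e = a≡c e , b≡d (second e) (second (sym e))
      where
      a≡c : ∀ {a b c d} → ⟨ a , b ⟩ ≡ ⟨ c , d ⟩ → a ≡ c
      a≡c {a} {b} {c} {d} e =
        [ c≡a , c≡a ]′ (to ∈｛｝ (subst (｛ a , a ｝ ∈_) e (from ∈｛｝ (inj₁ refl))))
        where
        c≡a : ∀ {u} → ｛ a , a ｝ ≡ ｛ c , u ｝ → a ≡ c
        c≡a p = [ sym , sym ]′ (to ∈｛｝ (subst (c ∈_) (sym p) (from ∈｛｝ (inj₁ refl))))

      second : ∀ {a b c d} → ⟨ a , b ⟩ ≡ ⟨ c , d ⟩ → b ≡ c ⊎ b ≡ d
      second {a} {b} {c} {d} e =
        [ (λ p → inj₁ ([ id , id ]′ (to ∈｛｝ (subst (b ∈_) p b∈))))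
        , (λ p → to ∈｛｝ (subst (b ∈_) p b∈)) ]′
          (to ∈｛｝ (subst (｛ a , b ｝ ∈_) e (from ∈｛｝ (inj₂ refl))))
        where
        b∈ : b ∈ ｛ a , b ｝
        b∈ = from ∈｛｝ (inj₂ refl)

      b≡d : b ≡ c ⊎ b ≡ d → d ≡ a ⊎ d ≡ b → b ≡ d
      b≡d (inj₂ p) _        = p
      b≡d (inj₁ p) (inj₂ q) = sym q
      -- In this case all four components coincide.
      b≡d (inj₁ p) (inj₁ q) = trans p (trans (sym (a≡c e)) (sym q))

    product : ∀ A B → ∃ λ P → RelationBetween P A B × (∀ {x y} → x ∈ A → y ∈ B → ⟨ x , y ⟩ ∈ P)
    product A B with comprehension
      (∃ᵗ (∃ᵗ (# 1F ∈ᵗ # 3F ∧ᵗ # 0F ∈ᵗ # 4F ∧ᵗ # 2F ≐ᵗ ⟨ # 1F , # 0F ⟩ᵗ)))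
      -- Both members of a Kuratowski pair are subsets of `A ∪ B`, so the pair lies in the double
      -- power set.
      (A ∷ B ∷ []) (proj₁ (powerset (proj₁ (powerset (A ∪ B)))))
    ... | P , P-spec = P , (λ p p∈ → proj₂ (to (P-spec p) p∈)) , λ {x} {y} x∈ y∈ →
      let x∈∪ : ∀ {w} → w ≡ x → w ∈ A ∪ B
          x∈∪ w≡x = from ∈∪ (inj₁ (subst (_∈ A) (sym w≡x) x∈))
          y∈∪ : ∀ {w} → w ≡ y → w ∈ A ∪ B
          y∈∪ w≡y = from ∈∪ (inj₂ (subst (_∈ B) (sym w≡y) y∈))
      in from (P-spec _)
        ( from (proj₂ (powerset _) _) (λ z z∈ → from (proj₂ (powerset _) _) (λ w w∈ →
            [ (λ e → [ x∈∪ , x∈∪ ]′ (to ∈｛｝ (subst (w ∈_) e w∈)))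
            , (λ e → [ x∈∪ , y∈∪ ]′ (to ∈｛｝ (subst (w ∈_) e w∈))) ]′ (to ∈｛｝ z∈)))
        , x , y , x∈ , y∈ , refl)

    -- The pair itself stays in the context of φ, below its two components.
    relation-comprehension : ∀ {n} (φ : TFormula (ℕ.suc (ℕ.suc (ℕ.suc n)))) (ρ : Vec V n) A B →
      ∃ λ r → RelationBetween r A B ×
              (∀ {x y} → ⟨ x , y ⟩ ∈ r ⇔ ((x ∈ A × y ∈ B) × SatT φ (y ∷ x ∷ ⟨ x , y ⟩ ∷ ρ)))
    relation-comprehension φ ρ A B with product A B
    ... | P , P-rel , P-full with comprehension (∃ᵗ (∃ᵗ (# 2F ≐ᵗ ⟨ # 1F , # 0F ⟩ᵗ ∧ᵗ φ))) ρ P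
    ... | r , r-spec = r , (λ p p∈ → P-rel p (proj₁ (to (r-spec p) p∈))) ,
      mk⇔ unpack λ where ((x∈ , y∈) , h) → from (r-spec _) (P-full x∈ y∈ , _ , _ , refl , h)
      where
      unpack : ∀ {x y} → ⟨ x , y ⟩ ∈ r → (x ∈ A × y ∈ B) × SatT φ (y ∷ x ∷ ⟨ x , y ⟩ ∷ ρ)
      unpack p∈ with to (r-spec _) p∈
      ... | p∈P , _ , _ , e , h with ⟨⟩-injective e | P-rel _ p∈P
      ... | refl , refl | _ , _ , x∈ , y∈ , e′ with ⟨⟩-injective e′
      ... | refl , refl = (x∈ , y∈) , h

  components : ∀ {r A B x y} → RelationBetween r A B → ⟨ x , y ⟩ ∈ r → x ∈ A × y ∈ B
  components rel p∈ with rel _ p∈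
  ... | _ , _ , x∈ , y∈ , e with ⟨⟩-injective e
  ... | refl , refl = x∈ , y∈

  -- Natural numbers and iteration along `ω`.

  ∅ : V
  ∅ = proj₁ (proj₁ (proj₂ infinity))

  ∅-empty : IsEmpty ∅
  ∅-empty = proj₁ (proj₂ (proj₁ (proj₂ infinity)))

  empty≡∅ : ∀ {e} → IsEmpty e → e ≡ ∅
  empty≡∅ empty = extensionality _ _ λ z → mk⇔ (⊥-elim ∘ empty z) (⊥-elim ∘ ∅-empty z)

  ⊆-antisym : ∀ {x y} → x ⊆ y → y ⊆ x → x ≡ y
  ⊆-antisym x⊆y y⊆x = extensionality _ _ λ z → mk⇔ (x⊆y z) (y⊆x z)

  n∈succ : ∀ {n} → n ∈ succ n
  n∈succ = from ∈succ (inj₂ refl)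

  ∅∈ω : ∅ ∈ ω
  ∅∈ω = from (proj₂ omega _) λ where
    v ((e , e-empty , e∈v) , _) → subst (_∈ v) (empty≡∅ e-empty) e∈v

  succ∈ω : ∀ {n} → n ∈ ω → succ n ∈ ω
  succ∈ω {n} n∈ω = from (proj₂ omega _) λ v v-ind →
    let s , s-suc , s∈v = proj₂ v-ind n (to (proj₂ omega n) n∈ω v v-ind)
    in subst (_∈ v) (to (determined λ z → ∈succ) s-suc) s∈v

  -- The members of `ω` satisfying `φ` form an inductive set, and `ω` is included in every inductive
  -- set.
  ω-induction : ∀ {k} (φ : TFormula (ℕ.suc k)) (ρ : Vec V k) → SatT φ (∅ ∷ ρ) →
                (∀ n → n ∈ ω → SatT φ (n ∷ ρ) → SatT φ (succ n ∷ ρ)) →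
                ∀ {n} → n ∈ ω → SatT φ (n ∷ ρ)
  ω-induction φ ρ base step {n} n∈ω = proj₂ (to (b-spec n) (to (proj₂ omega n) n∈ω b
    ( (∅ , ∅-empty , from (b-spec _) (∅∈ω , base))
    , λ m m∈b → let m∈ω , h = to (b-spec m) m∈b in
        succ m , (λ z → ∈succ) , from (b-spec _) (succ∈ω m∈ω , step m m∈ω h))))
    where
    b      = proj₁ (comprehension φ ρ ω)
    b-spec = proj₂ (comprehension φ ρ ω)

  ω-transitive : ∀ {n} → n ∈ ω → ∀ m → m ∈ n → m ⊆ n
  ω-transitive = ω-induction
    (∀ᵗ (# 0F ∈ᵗ # 1F ⇒ᵗ ∀ᵗ (# 0F ∈ᵗ # 1F ⇒ᵗ # 0F ∈ᵗ # 2F))) []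
    (λ m m∈∅ → ⊥-elim (∅-empty m m∈∅))
    (λ n _ IH m m∈ z z∈m → from ∈succ (inj₁
      ([ (λ m∈n → IH m m∈n z z∈m) , (λ m≡n → subst (z ∈_) m≡n z∈m) ]′ (to ∈succ m∈))))

  -- Each number belongs to the successor of the other. If this yields `m ∈ n` and `n ∈ m`,
  -- transitivity gives both inclusions.
  succ-injective : ∀ {m n} → m ∈ ω → n ∈ ω → succ m ≡ succ n → m ≡ n
  succ-injective {m} {n} m∈ω n∈ω e
    with to ∈succ (subst (m ∈_) e n∈succ) | to ∈succ (subst (n ∈_) (sym e) n∈succ)
  ... | inj₂ m≡n | _        = m≡n
  ... | inj₁ _   | inj₂ n≡m = sym n≡m
  ... | inj₁ m∈n | inj₁ n∈m = ⊆-antisym (ω-transitive n∈ω m m∈n) (ω-transitive m∈ω n n∈m)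

  -- Take for `f` the pairs common to all sets that contain `⟨ ∅ , a ⟩` and are closed under the
  -- step induced by `F`. Minimality makes every pair of `f` either the start or the result of a
  -- step, and uniqueness of values follows by induction.
  iteration : ∀ {W F a} → a ∈ W → RelationBetween F W W → TotalOn F W →
              (∀ x y y′ → ⟨ x , y ⟩ ∈ F → ⟨ x , y′ ⟩ ∈ F → y ≡ y′) →
              ∃ λ f → f ∶ ω ⟶ W ×
                (∀ n → n ∈ ω → ∀ x y → ⟨ n , x ⟩ ∈ f → ⟨ succ n , y ⟩ ∈ f → ⟨ x , y ⟩ ∈ F)
  iteration {W} {F} {a} a∈W F-rel F-total F-unique =
    f , (proj₁ f-spec , λ n n∈ω → let x , x∈ = f-total n∈ω in x , x∈ , λ {y} → f-unique n∈ω x y x∈)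
      , f-steps
    where
    Contains-orbit : V → Set ℓ
    Contains-orbit P = ⟨ ∅ , a ⟩ ∈ P ×
      (∀ n x y → ⟨ n , x ⟩ ∈ P → ⟨ x , y ⟩ ∈ F → ⟨ succ n , y ⟩ ∈ P)

    comp = relation-comprehension
      (∀ᵗ (⟨ # 4F , # 5F ⟩ᵗ ∈ᵗ # 0F ∧ᵗ
           ∀ᵗ (∀ᵗ (∀ᵗ (⟨ # 2F , # 1F ⟩ᵗ ∈ᵗ # 3F ⇒ᵗ ⟨ # 1F , # 0F ⟩ᵗ ∈ᵗ # 9F ⇒ᵗ
                       ⟨ succᵗ (# 2F) , # 0F ⟩ᵗ ∈ᵗ # 3F)))
           ⇒ᵗ # 3F ∈ᵗ # 0F))
      (∅ ∷ a ∷ F ∷ []) ω W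
    f = proj₁ comp
    f-spec : RelationBetween f ω W ×
      (∀ {n x} → ⟨ n , x ⟩ ∈ f ⇔
        ((n ∈ ω × x ∈ W) × (∀ P → Contains-orbit P → ⟨ n , x ⟩ ∈ P)))
    f-spec = proj₂ comp

    f-start : ⟨ ∅ , a ⟩ ∈ f
    f-start = from (proj₂ f-spec) ((∅∈ω , a∈W) , λ P → proj₁)

    f-next : ∀ {n x y} → ⟨ n , x ⟩ ∈ f → ⟨ x , y ⟩ ∈ F → ⟨ succ n , y ⟩ ∈ f
    f-next p∈ xFy = let (n∈ω , _) , h = to (proj₂ f-spec) p∈ in
      from (proj₂ f-spec) ( (succ∈ω n∈ω , proj₂ (components F-rel xFy))
                          , λ P P-orbit → proj₂ P-orbit _ _ _ (h P P-orbit) xFy)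

    f-inv : ∀ {n x} → ⟨ n , x ⟩ ∈ f → (n ≡ ∅ × x ≡ a)
            ⊎ ∃₂ λ m w → ⟨ m , w ⟩ ∈ f × ⟨ w , x ⟩ ∈ F × n ≡ succ m
    f-inv {n} {x} p∈ = proj₂ (proj₂ (to (proj₂ (proj₂ g)) (proj₂ (to (proj₂ f-spec) p∈) (proj₁ g)
      ( from (proj₂ (proj₂ g)) ((∅∈ω , a∈W) , f-start , inj₁ (refl , refl))
      , λ m w y q∈ wFy → let (m∈ω , _) , q∈f , _ = to (proj₂ (proj₂ g)) q∈ in
          from (proj₂ (proj₂ g)) ( (succ∈ω m∈ω , proj₂ (components F-rel wFy))
                                 , f-next q∈f wFy , inj₂ (m , w , q∈f , wFy , refl))))))
      where
      g = relation-comprehension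
        (# 2F ∈ᵗ # 5F ∧ᵗ
         ((# 1F ≐ᵗ # 3F ∧ᵗ # 0F ≐ᵗ # 4F)
          ∨ᵗ ∃ᵗ (∃ᵗ (⟨ # 1F , # 0F ⟩ᵗ ∈ᵗ # 7F ∧ᵗ ⟨ # 0F , # 2F ⟩ᵗ ∈ᵗ # 8F ∧ᵗ # 3F ≐ᵗ succᵗ (# 1F)))))
        (∅ ∷ a ∷ f ∷ F ∷ []) ω W

    f-total : ∀ {n} → n ∈ ω → ∃ λ x → ⟨ n , x ⟩ ∈ f
    f-total = ω-induction (∃ᵗ (⟨ # 1F , # 0F ⟩ᵗ ∈ᵗ # 2F)) (f ∷ []) (a , f-start)
      λ n _ (x , x∈) → let y , _ , xFy = F-total x (proj₂ (components (proj₁ f-spec) x∈))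
                       in y , f-next x∈ xFy

    succ≢∅ : ∀ {n} → ¬ (succ n ≡ ∅)
    succ≢∅ {n} e = ∅-empty n (subst (n ∈_) e n∈succ)

    f-unique : ∀ {n} → n ∈ ω → ∀ x y → ⟨ n , x ⟩ ∈ f → ⟨ n , y ⟩ ∈ f → x ≡ y
    f-unique = ω-induction
      (∀ᵗ (∀ᵗ (⟨ # 2F , # 1F ⟩ᵗ ∈ᵗ # 3F ⇒ᵗ ⟨ # 2F , # 0F ⟩ᵗ ∈ᵗ # 3F ⇒ᵗ # 1F ≐ᵗ # 0F)))
      (f ∷ []) base step
      where
      base : ∀ x y → ⟨ ∅ , x ⟩ ∈ f → ⟨ ∅ , y ⟩ ∈ f → x ≡ y
      base x y x∈ y∈ with f-inv x∈ | f-inv y∈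
      ... | inj₁ (_ , x≡a)             | inj₁ (_ , y≡a)             = trans x≡a (sym y≡a)
      ... | inj₂ (_ , _ , _ , _ , ∅≡s) | _                          = ⊥-elim (succ≢∅ (sym ∅≡s))
      ... | inj₁ _                     | inj₂ (_ , _ , _ , _ , ∅≡s) = ⊥-elim (succ≢∅ (sym ∅≡s))

      step : ∀ n → n ∈ ω → (∀ x y → ⟨ n , x ⟩ ∈ f → ⟨ n , y ⟩ ∈ f → x ≡ y) →
             ∀ x y → ⟨ succ n , x ⟩ ∈ f → ⟨ succ n , y ⟩ ∈ f → x ≡ y
      step n n∈ω IH x y x∈ y∈ with f-inv x∈ | f-inv y∈
      ... | inj₁ (s≡∅ , _) | _              = ⊥-elim (succ≢∅ s≡∅)
      ... | inj₂ _         | inj₁ (s≡∅ , _) = ⊥-elim (succ≢∅ s≡∅)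
      ... | inj₂ (m , w , w∈ , wFx , e) | inj₂ (m′ , w′ , w′∈ , w′Fy , e′)
        with succ-injective n∈ω (proj₁ (components (proj₁ f-spec) w∈)) e
           | succ-injective n∈ω (proj₁ (components (proj₁ f-spec) w′∈)) e′
      ... | refl | refl with IH w w′ w∈ w′∈
      ... | refl = F-unique w x y wFx w′Fy

    f-steps : ∀ n → n ∈ ω → ∀ x y → ⟨ n , x ⟩ ∈ f → ⟨ succ n , y ⟩ ∈ f → ⟨ x , y ⟩ ∈ F
    f-steps n n∈ω x y x∈ y∈ =
      -- `F` sends `x` to some `z`, which is then a value of `f` at `succ n` and so equals `y`.
      let z , _ , xFz = F-total x (proj₂ (components (proj₁ f-spec) x∈))
      in subst (λ u → ⟨ x , u ⟩ ∈ F) (f-unique (succ∈ω n∈ω) z y (f-next x∈ xFz) y∈) xFz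

-- Order of `ω` and thinning, with excluded middle.

module Classical {ℓ} (em : ExcludedMiddle ℓ) (M : ZF ℓ) where
  open SetTheory M
  open Sets M

  -- Induction on `n`: if `n ∈ m`, then `succ n ⊆ m`, which gives equality; otherwise `m ⊆ succ n`
  -- shrinks to `m ⊆ n`.
  ⊆⇒≡⊎∈ : ∀ {m n} → m ∈ ω → n ∈ ω → m ⊆ n → m ≡ n ⊎ m ∈ n
  ⊆⇒≡⊎∈ {m} m∈ω = ω-induction
    (∀ᵗ (# 0F ∈ᵗ # 2F ⇒ᵗ # 0F ∈ᵗ # 1F) ⇒ᵗ # 1F ≐ᵗ # 0F ∨ᵗ # 1F ∈ᵗ # 0F) (m ∷ [])
    (λ m⊆∅ → inj₁ (empty≡∅ λ z → ∅-empty z ∘ m⊆∅ z)) step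
    where
    step : ∀ n → n ∈ ω → (m ⊆ n → m ≡ n ⊎ m ∈ n) → m ⊆ succ n → m ≡ succ n ⊎ m ∈ succ n
    step n n∈ω IH m⊆s with em {n ∈ m}
    ... | yes n∈m = inj₁ (⊆-antisym m⊆s λ z z∈s →
          [ ω-transitive m∈ω n n∈m z , (λ z≡n → subst (_∈ m) (sym z≡n) n∈m) ]′ (to ∈succ z∈s))
    ... | no n∉m = inj₂ (from ∈succ ([ inj₂ , inj₁ ]′ (IH λ z z∈m →
          [ id , (λ z≡n → ⊥-elim (n∉m (subst (_∈ m) z≡n z∈m))) ]′ (to ∈succ (m⊆s z z∈m)))))

  -- If `I` had no least element, every natural number would be a lower bound by induction: a lower
  -- bound `n` is not in `I`, so it belongs to each member of `I`, and `succ n` is a lower bound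
  -- too. But then `i` itself is least.
  least : ∀ {I i} → I ⊆ ω → i ∈ I → ∃ λ n → n ∈ I × (∀ m → m ∈ I → n ⊆ m)
  least {I} {i} I⊆ω i∈I = decidable-stable em λ ¬least →
    ¬least (i , i∈I , ω-induction
      (∀ᵗ (# 0F ∈ᵗ # 2F ⇒ᵗ ∀ᵗ (# 0F ∈ᵗ # 2F ⇒ᵗ # 0F ∈ᵗ # 1F))) (I ∷ [])
      (λ m _ z z∈∅ → ⊥-elim (∅-empty z z∈∅))
      (λ n n∈ω n-below m m∈I z z∈s →
        [ n-below m m∈I z
        , (λ z≡n → subst (_∈ m) (sym z≡n)
            ([ (λ n≡m → ⊥-elim (¬least (n , subst (_∈ I) (sym n≡m) m∈I , n-below))) , id ]′
              (⊆⇒≡⊎∈ n∈ω (I⊆ω m m∈I) (n-below m m∈I)))) ]′ (to ∈succ z∈s))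
      (I⊆ω i i∈I))

  -- Only `y` has to lie in `A`: a move into `A` excludes every other move inside `W`, even one to a
  -- point outside `A`. The property passes to subsets of `W` and to subrelations, so two prunings
  -- can be combined.
  UniqueInto : V → V → V → Set ℓ
  UniqueInto A R W = ∀ x y y′ → x ∈ W → y ∈ W → y′ ∈ W → y ∈ A →
                     ⟨ x , y ⟩ ∈ R → ⟨ x , y′ ⟩ ∈ R → y ≡ y′

  -- Where moves into `A` exist, keep the one whose target has the least index in `f`; elsewhere
  -- keep all moves. Since `f` is a function, the index determines the target.
  thin : ∀ {A T R f} → f ∶ ω ⟶ A → (∀ z → z ∈ T → z ∈ A → ∃ λ n → ⟨ n , z ⟩ ∈ f) →
         TotalOn R T →
         ∃ λ R′ → (∀ x y → ⟨ x , y ⟩ ∈ R′ → ⟨ x , y ⟩ ∈ R) × TotalOn R′ T × UniqueInto A R′ T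
  thin {A} {T} {R} {f} (f-rel , f-fun) f-covers R-total =
    R′ , (λ x y xR′y → proj₁ (proj₂ (to R′-spec xR′y))) , R′-total , R′-unique
    where
    NoneInA : V → Set ℓ
    NoneInA x = ∀ y → y ∈ T → ⟨ x , y ⟩ ∈ R → ¬ (y ∈ A)

    Earliest : V → V → Set ℓ
    Earliest x y = ∃ λ n → ⟨ n , y ⟩ ∈ f ×
      (∀ m y′ → y′ ∈ T → ⟨ x , y′ ⟩ ∈ R → ⟨ m , y′ ⟩ ∈ f → n ⊆ m)

    comp = relation-comprehension
      (⟨ # 1F , # 0F ⟩ᵗ ∈ᵗ # 4F ∧ᵗ
        (∀ᵗ (# 0F ∈ᵗ # 4F ⇒ᵗ ⟨ # 2F , # 0F ⟩ᵗ ∈ᵗ # 5F ⇒ᵗ ¬ᵗ (# 0F ∈ᵗ # 6F))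
        ∨ᵗ ∃ᵗ (⟨ # 0F , # 1F ⟩ᵗ ∈ᵗ # 7F ∧ᵗ
               ∀ᵗ (∀ᵗ (# 0F ∈ᵗ # 6F ⇒ᵗ ⟨ # 4F , # 0F ⟩ᵗ ∈ᵗ # 7F ⇒ᵗ ⟨ # 1F , # 0F ⟩ᵗ ∈ᵗ # 9F ⇒ᵗ
                       ∀ᵗ (# 0F ∈ᵗ # 3F ⇒ᵗ # 0F ∈ᵗ # 2F))))))
      (T ∷ R ∷ A ∷ f ∷ []) T T
    R′ = proj₁ comp
    R′-spec : ∀ {x y} → ⟨ x , y ⟩ ∈ R′ ⇔
              ((x ∈ T × y ∈ T) × ⟨ x , y ⟩ ∈ R × (NoneInA x ⊎ Earliest x y))
    R′-spec = proj₂ (proj₂ comp)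

    f-unique : ∀ {n y y′} → ⟨ n , y ⟩ ∈ f → ⟨ n , y′ ⟩ ∈ f → y ≡ y′
    f-unique y∈ y′∈ = let _ , _ , unique = f-fun _ (proj₁ (components f-rel y∈))
                      in trans (sym (unique y∈)) (unique y′∈)

    R′-total : TotalOn R′ T
    R′-total x x∈T with em {∃ λ y → y ∈ T × ⟨ x , y ⟩ ∈ R × y ∈ A}
    ... | no none = let y , y∈T , xRy = R-total x x∈T in
      y , y∈T , from R′-spec
        ((x∈T , y∈T) , xRy , inj₁ λ y′ y′∈T xRy′ y′∈A → none (y′ , y′∈T , xRy′ , y′∈A))
    ... | yes (y , y∈T , xRy , y∈A) =
      let i , iy∈f = f-covers y y∈T y∈A
          n , n∈I , n-least = least (λ m → proj₁ ∘ to (I-spec m))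
            (from (I-spec i) (proj₁ (components f-rel iy∈f) , y , y∈T , xRy , iy∈f))
          _ , z , z∈T , xRz , nz∈f = to (I-spec n) n∈I
      in z , z∈T , from R′-spec ((x∈T , z∈T) , xRz , inj₂ (n , nz∈f , λ m y′ y′∈T xRy′ my′∈f →
           n-least m (from (I-spec m) (proj₁ (components f-rel my′∈f) , y′ , y′∈T , xRy′ , my′∈f))))
      where
      I-comp = comprehension
        (∃ᵗ (# 0F ∈ᵗ # 3F ∧ᵗ ⟨ # 2F , # 0F ⟩ᵗ ∈ᵗ # 4F ∧ᵗ ⟨ # 1F , # 0F ⟩ᵗ ∈ᵗ # 5F))
        (x ∷ T ∷ R ∷ f ∷ []) ω
      I-spec = proj₂ I-comp

    R′-unique : UniqueInto A R′ T
    R′-unique x y y′ x∈T y∈T y′∈T y∈A xR′y xR′y′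
      with to R′-spec xR′y | to R′-spec xR′y′
    ... | _ , xRy , inj₁ none | _ = ⊥-elim (none y y∈T xRy y∈A)
    ... | _ , xRy , inj₂ _ | _ , _ , inj₁ none = ⊥-elim (none y y∈T xRy y∈A)
    ... | _ , xRy , inj₂ (n , ny∈f , n-least) | _ , xRy′ , inj₂ (n′ , n′y′∈f , n′-least) =
      f-unique ny∈f (subst (λ k → ⟨ k , y′ ⟩ ∈ f)
        (⊆-antisym (n′-least n y y∈T xRy ny∈f) (n-least n′ y′ y′∈T xRy′ n′y′∈f)) n′y′∈f)

  -- Passing to a nonempty subset with unique moves into `A`.

  prune : ∀ {A W R} → DC A → (∃ λ w → w ∈ W) → TotalOn R W →
          ∃₂ λ W′ R′ → (∃ λ w → w ∈ W′) × W′ ⊆ W ×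
            (∀ x y → ⟨ x , y ⟩ ∈ R′ → ⟨ x , y ⟩ ∈ R) × TotalOn R′ W′ × UniqueInto A R′ W′
  prune {A} {W} {R} dc (w , w∈W) R-total
    with em {∃ λ C → (∃ λ c → c ∈ C) × C ⊆ W × (∀ z → z ∈ C → ¬ (z ∈ A)) × TotalOn R C}
  ... | yes (C , inhabited , C⊆W , C∩A=∅ , C-total) =
    C , R , inhabited , C⊆W , (λ x y → id) , C-total
      , λ x y y′ _ y∈C _ y∈A → ⊥-elim (C∩A=∅ y y∈C y∈A)
  ... | no avoidance =
    let R′ , R′⊆R , R′-total , R′-unique = thin f-fun T-covered T-total in
    T , R′ , (a₁ , A′⊆T a₁ (from A′-spec (a₁∈W , succ ∅ , a₁∈f)))
      , (λ z → proj₁ ∘ to T-spec) , R′⊆R , R′-total , R′-unique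
    where
    Closed : V → Set ℓ
    Closed D = ∀ b d → b ∈ W → ¬ (b ∈ A) → d ∈ D → ⟨ b , d ⟩ ∈ R → b ∈ D

    closedᵗ : ∀ {n} (D A W R : Fin n) → TFormula n
    closedᵗ D A W R = ∀ᵗ (∀ᵗ
      (# 1F ∈ᵗ # suc (suc W) ⇒ᵗ ¬ᵗ (# 1F ∈ᵗ # suc (suc A)) ⇒ᵗ # 0F ∈ᵗ # suc (suc D) ⇒ᵗ
       ⟨ # 1F , # 0F ⟩ᵗ ∈ᵗ # suc (suc R) ⇒ᵗ # 1F ∈ᵗ # suc (suc D)))

    -- `Closed` never forces a point of `A` into `D`, so a start in `A` is judged by its successors.
    Meets : V → V → Set ℓ
    Meets a D = ∃ λ d → d ∈ D × ⟨ a , d ⟩ ∈ R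

    -- Some R-path from a to a′ has all its intermediate points in W ∖ A.
    Reaches : V → V → Set ℓ
    Reaches a a′ = ∀ D → Closed D → a′ ∈ D → Meets a D

    -- `A` may stick out of `W`, while `DC A` asks for totality on all of `A`. Points outside `W`
    -- are therefore sent to arbitrary points of `A` in `W`.
    S-comp = relation-comprehension
      (# 0F ∈ᵗ # 4F ∧ᵗ
        (# 1F ∈ᵗ # 4F ⇒ᵗ ∀ᵗ (closedᵗ 0F 4F 5F 6F ⇒ᵗ # 1F ∈ᵗ # 0F ⇒ᵗ
          ∃ᵗ (# 0F ∈ᵗ # 1F ∧ᵗ ⟨ # 3F , # 0F ⟩ᵗ ∈ᵗ # 7F))))
      (A ∷ W ∷ R ∷ []) A A
    S = proj₁ S-comp
    S-spec : ∀ {a a′} → ⟨ a , a′ ⟩ ∈ S ⇔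
             ((a ∈ A × a′ ∈ A) × a′ ∈ W × (a ∈ W → Reaches a a′))
    S-spec = proj₂ (proj₂ S-comp)

    W-meets-A : ∃ λ a → a ∈ A × a ∈ W
    W-meets-A = decidable-stable em λ none →
      avoidance (W , (w , w∈W) , (λ z → id) , (λ z z∈W z∈A → none (z , z∈A , z∈W)) , R-total)

    -- If a cannot reach A, the points it reaches form a subset of W ∖ A on
    -- which R is total.
    reaches-A : ∀ a → a ∈ W → ∃ λ a′ → a′ ∈ A × a′ ∈ W × Reaches a a′
    reaches-A a a∈W = decidable-stable em λ none →
      -- Classically these are the points `z` of `W` with `Reaches a z`, put as the absence of a
      -- counterexample `D`.
      let C , spec = comprehension
            (¬ᵗ (∃ᵗ (closedᵗ 0F 3F 4F 5F ∧ᵗ # 1F ∈ᵗ # 0F ∧ᵗ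
                     ¬ᵗ (∃ᵗ (# 0F ∈ᵗ # 1F ∧ᵗ ⟨ # 3F , # 0F ⟩ᵗ ∈ᵗ # 6F)))))
            (a ∷ A ∷ W ∷ R ∷ []) W
          C-spec : ∀ z → z ∈ C ⇔ (z ∈ W × ¬ (∃ λ D → Closed D × z ∈ D × ¬ Meets a D))
          C-spec = spec
          C∩A=∅ : ∀ z → z ∈ C → ¬ (z ∈ A)
          C∩A=∅ z z∈C z∈A = let z∈W , h = to (C-spec z) z∈C in
            none (z , z∈A , z∈W , λ D closed z∈D →
              decidable-stable em λ misses → h (D , closed , z∈D , misses))
          v , v∈W , aRv = R-total a a∈W
          v∈C = from (C-spec v) (v∈W , λ (D , _ , v∈D , misses) → misses (v , v∈D , aRv))
          C-total : TotalOn R C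
          C-total z z∈C =
            let z∈W , h = to (C-spec z) z∈C
                u , u∈W , zRu = R-total z z∈W
            -- A closed `D` containing `u` contains its predecessor `z`, which is outside `A`; hence
            -- `a` meets `D`.
            in u , from (C-spec u) (u∈W , λ (D , closed , u∈D , misses) →
                     h (D , closed , closed z u z∈W (C∩A=∅ z z∈C) u∈D zRu , misses)) , zRu
      in avoidance (C , (v , v∈C) , (λ z → proj₁ ∘ to (C-spec z)) , C∩A=∅ , C-total)

    S-total : TotalOn S A
    S-total a a∈A with em {a ∈ W}
    ... | yes a∈W = let a′ , a′∈A , a′∈W , r = reaches-A a a∈W in
      a′ , a′∈A , from S-spec ((a∈A , a′∈A) , a′∈W , λ _ → r)
    ... | no a∉W = let a′ , a′∈A , a′∈W = W-meets-A in
      a′ , a′∈A , from S-spec ((a∈A , a′∈A) , a′∈W , ⊥-elim ∘ a∉W)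

    S-sequence = dc S (proj₁ (proj₂ S-comp))
      (let a , a∈A , _ = W-meets-A ; _ , _ , aSa′ = S-total a a∈A in _ , aSa′) S-total
    f       = proj₁ S-sequence
    f-fun   = proj₁ (proj₂ S-sequence)
    f-steps = proj₂ (proj₂ S-sequence)

    f-next : ∀ {n a} → ⟨ n , a ⟩ ∈ f → ∃ λ a′ → ⟨ succ n , a′ ⟩ ∈ f × a′ ∈ W × (a ∈ W → Reaches a a′)
    f-next {n} {a} na∈f =
      let n∈ω = proj₁ (components (proj₁ f-fun) na∈f)
          a′ , a′∈f , _ = proj₂ f-fun (succ n) (succ∈ω n∈ω)
      in a′ , a′∈f , proj₂ (to S-spec (f-steps n n∈ω a a′ na∈f a′∈f))

    -- The term at `∅` may lie outside `W`. All targets of `S` are in `W`, so the term at `succ ∅`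
    -- is sure to be there.
    second-term = f-next (proj₁ (proj₂ (proj₂ f-fun ∅ ∅∈ω)))
    a₁    = proj₁ second-term
    a₁∈f  = proj₁ (proj₂ second-term)
    a₁∈W  = proj₁ (proj₂ (proj₂ second-term))

    -- Cutting the range of `f` down to `W` loses at most the term at `∅`.
    A′-comp = comprehension (∃ᵗ (⟨ # 0F , # 1F ⟩ᵗ ∈ᵗ # 2F)) (f ∷ []) W
    A′ = proj₁ A′-comp
    A′-spec : ∀ {z} → z ∈ A′ ⇔ (z ∈ W × ∃ λ n → ⟨ n , z ⟩ ∈ f)
    A′-spec {z} = proj₂ A′-comp z

    -- Defining `T` as an intersection provides induction: every closed set including `A′` includes
    -- `T`.
    T-comp = comprehension
      (∀ᵗ (closedᵗ 0F 3F 4F 5F ⇒ᵗ ∀ᵗ (# 0F ∈ᵗ # 3F ⇒ᵗ # 0F ∈ᵗ # 1F) ⇒ᵗ # 1F ∈ᵗ # 0F))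
      (A′ ∷ A ∷ W ∷ R ∷ []) W
    T = proj₁ T-comp
    T-spec : ∀ {z} → z ∈ T ⇔ (z ∈ W × (∀ D → Closed D → A′ ⊆ D → z ∈ D))
    T-spec {z} = proj₂ T-comp z

    A′⊆T : A′ ⊆ T
    A′⊆T a a∈A′ = from T-spec (proj₁ (to A′-spec a∈A′) , λ D _ A′⊆D → A′⊆D a a∈A′)

    T-closed : Closed T
    T-closed b d b∈W b∉A d∈T bRd = from T-spec (b∈W , λ D closed A′⊆D →
      closed b d b∈W b∉A (proj₂ (to T-spec d∈T) D closed A′⊆D) bRd)

    -- `D` agrees with `A′` on `A` and contains all of `W` outside `A`. It is thus closed, and it
    -- includes `T`.
    T-covered : ∀ z → z ∈ T → z ∈ A → ∃ λ n → ⟨ n , z ⟩ ∈ f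
    T-covered z z∈T z∈A =
      let D , D-spec = comprehension (# 0F ∈ᵗ # 1F ⇒ᵗ # 0F ∈ᵗ # 2F) (A ∷ A′ ∷ []) W
          z∈D = proj₂ (to T-spec z∈T) D
            (λ b d b∈W b∉A _ _ → from (D-spec b) (b∈W , ⊥-elim ∘ b∉A))
            (λ a a∈A′ → from (D-spec a) (proj₁ (to A′-spec a∈A′) , λ _ → a∈A′))
      in proj₂ (to A′-spec (proj₂ (to (D-spec z) z∈D) z∈A))

    -- The term following `a` is reached from `a` and lies in the closed set `T`, so some successor
    -- of `a` is in `T`.
    A′-meets-T : ∀ a → a ∈ A′ → Meets a T
    A′-meets-T a a∈A′ =
      let a∈W , n , na∈f = to A′-spec a∈A′
          a′ , a′∈f , a′∈W , reaches = f-next na∈f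
      in reaches a∈W T T-closed (A′⊆T a′ (from A′-spec (a′∈W , succ n , a′∈f)))

    -- Induction along `T`: the points of `T` with a successor in `T` form a closed set including
    -- `A′`.
    T-total : TotalOn R T
    T-total z z∈T =
      let D , D-spec = comprehension (∃ᵗ (# 0F ∈ᵗ # 2F ∧ᵗ ⟨ # 1F , # 0F ⟩ᵗ ∈ᵗ # 3F)) (T ∷ R ∷ []) T
          z∈D = proj₂ (to T-spec z∈T) D
            (λ b d b∈W b∉A d∈D bRd → let d∈T = proj₁ (to (D-spec d) d∈D) in
              from (D-spec b) (T-closed b d b∈W b∉A d∈T bRd , d , d∈T , bRd))
            (λ a a∈A′ → from (D-spec a) (A′⊆T a a∈A′ , A′-meets-T a a∈A′))
      in proj₂ (to (D-spec z) z∈D)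

-- Pruning for `X`, then for `Y`, then iterating.

theorem5p1 : ∀ {ℓ} → ExcludedMiddle ℓ → (M : ZF ℓ) → let open SetTheory M in
    ∀ X Y → DC X → DC Y → DC (X ∪ Y)
theorem5p1 em M X Y dcX dcY R R-rel (p , p∈R) R-total
  with (let open Classical em M in prune dcX (let _ , _ , x∈ , _ = R-rel p p∈R in _ , x∈) R-total)
... | W₁ , R₁ , inhabited₁ , W₁⊆ , R₁⊆ , R₁-total , R₁-unique
  with (let open Classical em M in prune dcY inhabited₁ R₁-total)
... | W₂ , R₂ , (a , a∈W₂) , W₂⊆ , R₂⊆ , R₂-total , R₂-unique
  -- `R₂` may hold pairs outside `W₂`, while `iteration` asks for a relation on `W₂`.
  with (let open Sets M in relation-comprehension (⟨ # 1F , # 0F ⟩ᵗ ∈ᵗ # 3F) (R₂ ∷ []) W₂ W₂)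
... | F , F-rel , F-spec = conclude (iteration a∈W₂ F-rel F-total F-unique)
  where
  open SetTheory M
  open Sets M

  F-total : TotalOn F W₂
  F-total x x∈ = let y , y∈ , xR₂y = R₂-total x x∈ in y , y∈ , from F-spec ((x∈ , y∈) , xR₂y)

  F-unique : ∀ x y y′ → ⟨ x , y ⟩ ∈ F → ⟨ x , y′ ⟩ ∈ F → y ≡ y′
  F-unique x y y′ xFy xFy′ with to F-spec xFy | to F-spec xFy′
  ... | (x∈ , y∈) , xR₂y | (_ , y′∈) , xR₂y′ =
    -- Every target lies in `X` or in `Y`. For `X`, the uniqueness of `R₁` on `W₁` is inherited by
    -- `R₂` on `W₂`.
    [ (λ y∈X → R₁-unique x y y′ (W₂⊆ x x∈) (W₂⊆ y y∈) (W₂⊆ y′ y′∈) y∈X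
                 (R₂⊆ x y xR₂y) (R₂⊆ x y′ xR₂y′))
    , (λ y∈Y → R₂-unique x y y′ x∈ y∈ y′∈ y∈Y xR₂y xR₂y′) ]′
    (to ∈∪ (W₁⊆ y (W₂⊆ y y∈)))

  IsSequence : V → V → V → Set _
  IsSequence f Z Q = f ∶ ω ⟶ Z ×
    (∀ n → n ∈ ω → ∀ x y → ⟨ n , x ⟩ ∈ f → ⟨ succ n , y ⟩ ∈ f → ⟨ x , y ⟩ ∈ Q)

  conclude : (∃ λ f → IsSequence f W₂ F) → ∃ λ f → IsSequence f (X ∪ Y) R
  conclude (f , (f-rel , f-fun) , f-steps) = f ,
    ( (λ q q∈ → let n , x , n∈ω , x∈ , e = f-rel q q∈ in n , x , n∈ω , W₁⊆ x (W₂⊆ x x∈) , e)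
    , f-fun) ,
    λ n n∈ω x y nx∈f sy∈f →
      R₁⊆ x y (R₂⊆ x y (proj₂ (to F-spec (f-steps n n∈ω x y nx∈f sy∈f))))
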